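{- For every integer $t\ge 1$, with $v=4t+1$, the $(v,2,1)$-BIBD on a $v$-set $X$ (whose blocks are all $2$-subsets of $X$) has a strong nesting $\phi:\mathcal{A}\to Y$ with $X\subseteq Y$ and $|Y|=w=6t+2$, and this is optimal: no strong nesting of this BIBD has $|Y|<6t+2$.
   Context: A $(v,k,\lambda)$-BIBD is a pair $(X,\mathcal{A})$ where $X$ is a set of $v$ points and $\mathcal{A}$ is a multiset of $k$-subsets of $X$ (blocks) such that every pair of distinct points lies in exactly $\lambda$ blocks. Given a $(v,k,\lambda)$-BIBD $(X,\mathcal{A})$ and a set $Y\supseteq X$ with $|Y|=w$, a map $\phi:\mathcal{A}\to Y$ is a strong nesting if (1) $\phi(A)\notin A$ for every block $A\in\mathcal{A}$, and (2) the multiset of pairs $\{\{x,\phi(A)\}: A\in\mathcal{A},\ x\in A\}$ (one pair for each block $A$, counted with multiplicity in $\mathcal{A}$, and each $x\in A$) consists of distinct pairs. A strong nesting is optimal if $w=|Y|$ is as small as possible. -}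

module Defs where

open import Data.Fin.Base using (Fin; zero; suc)
open import Data.Fin.Subset using (Subset; inside; outside; _∈_; _⊆_; ∣_∣; ⁅_⁆; _∪_)
open import Data.Fin.Subset.Properties using (_∈?_; ⊆-antisym; ∪-identityˡ; ∪-identityʳ; ∣⁅x⁆∣≡1; x∈⁅x⁆; x∈⁅y⁆⇒x≡y; x∈p∪q⁺; x∈p∪q⁻; p⊂q⇒∣p∣<∣q∣)
open import Data.List.Base using (List; []; _∷_; _++_; map; filter; length; lookup)
open import Data.List.Membership.Propositional using () renaming (_∈_ to _∈ᴸ_)
open import Data.List.Membership.Propositional.Properties using (∈-map⁺; ∈-map⁻; ∈-++⁺ˡ; ∈-++⁺ʳ; ∈-filter⁺)
open import Data.List.Properties using (filter-none; filter-accept; filter-reject)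
open import Data.List.Relation.Unary.All as All using (All; []; _∷_)
open import Data.List.Relation.Unary.All.Properties using (all-filter)
open import Data.List.Relation.Unary.AllPairs using ([]; _∷_)
open import Data.List.Relation.Unary.Any using (here; there)
open import Data.List.Relation.Unary.Unique.Propositional using (Unique)
open import Data.List.Relation.Unary.Unique.Propositional.Properties as Unique using ()
open import Data.Nat.Base using (ℕ; zero; suc; _<_)
open import Data.Nat.Properties using (_≟_; <-irrefl)
open import Data.Product.Base using (_×_; _,_; ∃-syntax)
open import Data.Sum.Base using (inj₁; inj₂)
open import Data.Vec.Base using ([]; _∷_)
open import Data.Vec.Properties using (∷-injectiveʳ)
open import Function.Bundles using (_↣_; Injection)
open import Relation.Binary.PropositionalEquality using (_≡_; _≢_; refl; sym; trans; cong; subst)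
open import Relation.Nullary using (¬_; yes; no; contradiction)
open import Relation.Nullary.Decidable using (_×-dec_)
open import Relation.Unary using (Decidable)

-- The point set is Fin v.  The multiset of blocks is a list, so a repeated
-- block occurs at several positions.
record BIBD (v k r : ℕ) : Set where
  field
    blocks   : List (Subset v)
    sizes    : All (λ A → ∣ A ∣ ≡ k) blocks
    balanced : ∀ x y → x ≢ y → length (filter (λ A → x ∈? A ×-dec y ∈? A) blocks) ≡ r

  -- An element of the multiset is a position in the list.
  Block : Set
  Block = Fin (length blocks)

  points : Block → Subset v
  points = lookup blocks

-- Y is Fin w; the inclusion X ⊆ Y is an arbitrary injection.
record StrongNesting {v k r : ℕ} (D : BIBD v k r) (w : ℕ) : Set where
  open BIBD D
  field
    inclusion : Fin v ↣ Fin w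
    φ         : Block → Fin w

  ι : Fin v → Fin w
  ι = Injection.to inclusion

  -- The unordered pair {x, φ(A)}, as a subset of Y.
  pair : Block → Fin v → Subset w
  pair A x = ⁅ ι x ⁆ ∪ ⁅ φ A ⁆

  field
    φ-avoids : ∀ A x → x ∈ points A → φ A ≢ ι x
    distinct : ∀ A B x y → x ∈ points A → y ∈ points B →
               pair A x ≡ pair B y → A ≡ B × x ≡ y

Optimal : ∀ {v k r} {D : BIBD v k r} {w} → StrongNesting D w → Set
Optimal {D = D} {w = w} _ = ∀ w′ → w′ < w → ¬ StrongNesting D w′

subsets : ∀ n → List (Subset n)
subsets zero    = [] ∷ []
subsets (suc n) = map (outside ∷_) (subsets n) ++ map (inside ∷_) (subsets n)

twoSubsets : ∀ v → List (Subset v)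
twoSubsets v = filter (λ A → ∣ A ∣ ≟ 2) (subsets v)

∈-subsets : ∀ {n} (A : Subset n) → A ∈ᴸ subsets n
∈-subsets []            = here refl
∈-subsets (outside ∷ A) = ∈-++⁺ˡ (∈-map⁺ (outside ∷_) (∈-subsets A))
∈-subsets (inside ∷ A)  = ∈-++⁺ʳ (map (outside ∷_) (subsets _)) (∈-map⁺ (inside ∷_) (∈-subsets A))

subsets-unique : ∀ n → Unique (subsets n)
subsets-unique zero    = [] ∷ []
subsets-unique (suc n) =
  Unique.++⁺ (Unique.map⁺ ∷-injectiveʳ (subsets-unique n))
             (Unique.map⁺ ∷-injectiveʳ (subsets-unique n))
             (λ (p , q) → outside≢inside (∈-map⁻ (outside ∷_) p) (∈-map⁻ (inside ∷_) q))
  where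
  outside≢inside : ∀ {A : Subset (suc n)} →
                   (∃[ B ] B ∈ᴸ subsets n × A ≡ outside ∷ B) →
                   ¬ (∃[ B ] B ∈ᴸ subsets n × A ≡ inside ∷ B)
  outside≢inside (_ , _ , refl) (_ , _ , ())

∣⁅x⁆∪⁅y⁆∣≡2 : ∀ {n} (x y : Fin n) → x ≢ y → ∣ ⁅ x ⁆ ∪ ⁅ y ⁆ ∣ ≡ 2
∣⁅x⁆∪⁅y⁆∣≡2 zero    zero    x≢y = contradiction refl x≢y
∣⁅x⁆∪⁅y⁆∣≡2 zero    (suc y) _   = cong suc (trans (cong ∣_∣ (∪-identityˡ ⁅ y ⁆)) (∣⁅x⁆∣≡1 y))
∣⁅x⁆∪⁅y⁆∣≡2 (suc x) zero    _   = cong suc (trans (cong ∣_∣ (∪-identityʳ ⁅ x ⁆)) (∣⁅x⁆∣≡1 x))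
∣⁅x⁆∪⁅y⁆∣≡2 (suc x) (suc y) x≢y = ∣⁅x⁆∪⁅y⁆∣≡2 x y (λ eq → x≢y (cong suc eq))

⊆∧∣∣≡⇒≡ : ∀ {n} {A B : Subset n} → A ⊆ B → ∣ A ∣ ≡ ∣ B ∣ → A ≡ B
⊆∧∣∣≡⇒≡ {A = A} {B} A⊆B eq = ⊆-antisym A⊆B B⊆A
  where
  B⊆A : B ⊆ A
  B⊆A {x} x∈B with x ∈? A
  ... | yes x∈A = x∈A
  ... | no  x∉A = contradiction (p⊂q⇒∣p∣<∣q∣ (A⊆B , x , x∈B , x∉A)) (<-irrefl eq)

twoSubset≡pair : ∀ {n} {x y : Fin n} {A : Subset n} → x ≢ y → ∣ A ∣ ≡ 2 →
                 x ∈ A → y ∈ A → A ≡ ⁅ x ⁆ ∪ ⁅ y ⁆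
twoSubset≡pair {x = x} {y} {A} x≢y ∣A∣≡2 x∈A y∈A =
  sym (⊆∧∣∣≡⇒≡ pair⊆A (trans (∣⁅x⁆∪⁅y⁆∣≡2 x y x≢y) (sym ∣A∣≡2)))
  where
  pair⊆A : ⁅ x ⁆ ∪ ⁅ y ⁆ ⊆ A
  pair⊆A {z} z∈ with x∈p∪q⁻ ⁅ x ⁆ ⁅ y ⁆ z∈
  ... | inj₁ z∈x = subst (_∈ A) (sym (x∈⁅y⁆⇒x≡y x z∈x)) x∈A
  ... | inj₂ z∈y = subst (_∈ A) (sym (x∈⁅y⁆⇒x≡y y z∈y)) y∈A

length-filter-unique : ∀ {A : Set} {P : A → Set} (P? : Decidable P) {a : A} {as : List A} →
                       Unique as → a ∈ᴸ as → P a → All (λ b → P b → b ≡ a) as →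
                       length (filter P? as) ≡ 1
length-filter-unique P? {as = _ ∷ bs} (b∉bs ∷ _) (here refl) Pa (_ ∷ only)
  rewrite filter-accept P? {xs = bs} Pa =
  cong suc (cong length (filter-none P? (All.zipWith (λ (b≢c , c≡b) Pc → b≢c (sym (c≡b Pc))) (b∉bs , only))))
length-filter-unique P? {as = _ ∷ bs} (b∉bs ∷ u) (there a∈bs) Pa (b≡a ∷ only)
  rewrite filter-reject P? {xs = bs} (λ Pb → All.lookup b∉bs a∈bs (b≡a Pb)) =
  length-filter-unique P? u a∈bs Pa only

twoSubsetBIBD : ∀ v → BIBD v 2 1
twoSubsetBIBD v = record
  { blocks   = twoSubsets v
  ; sizes    = sizes
  ; balanced = λ x y x≢y →
      length-filter-unique (λ A → x ∈? A ×-dec y ∈? A)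
        (Unique.filter⁺ (λ A → ∣ A ∣ ≟ 2) (subsets-unique v))
        (∈-filter⁺ (λ A → ∣ A ∣ ≟ 2) (∈-subsets (⁅ x ⁆ ∪ ⁅ y ⁆)) (∣⁅x⁆∪⁅y⁆∣≡2 x y x≢y))
        (x∈p∪q⁺ (inj₁ (x∈⁅x⁆ x)) , x∈p∪q⁺ (inj₂ (x∈⁅x⁆ y)))
        (All.map (λ ∣A∣≡2 (x∈A , y∈A) → twoSubset≡pair x≢y ∣A∣≡2 x∈A y∈A) sizes)
  }
  where
  sizes : All (λ A → ∣ A ∣ ≡ 2) (twoSubsets v)
  sizes = all-filter (λ A → ∣ A ∣ ≟ 2) (subsets v)

{-# OPTIONS --safe #-}
module Submission where

-- Lower bound.  Regard φ as a colouring of the edges of K_v, v = 4t + 1, by points of Y.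
-- Every colour saturates an even number of points, so at most v - 1.  For a colour y ∈ X, a
-- point x saturated by y forbids y from being saturated by x, so the colours in X saturate at
-- most v (v - 1) / 2 points altogether and are short of the maximum by at least v (v - 1) / 2.
-- Since all colours together saturate v (v - 1) points, this gives
-- w (v - 1) ≥ v (v - 1) + v (v - 1) / 2, that is 2 w ≥ 3 v.
--
-- Construction.  On ℤ / (4t + 1), colour an edge {x , u} at cyclic distance more than t by the
-- point (x + u - t) / 2.  The remaining edges form the t-th power of a cycle, which is properly
-- coloured by the 2t + 1 points outside X: with 0 ≤ x , u ≤ 4t the colour is x + u modulo
-- 2t + 1, increased by 1 when both ends exceed 3t and by t + 1 when ∣ x - u ∣ = 3t + 1.

open import Defs
open import Algebra.Bundles using (module AbelianGroup)
open import Data.Fin.Base using (Fin; zero; suc; toℕ; join; splitAt)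
open import Data.Fin.Properties using (_≟_; any?; toℕ-fromℕ<; toℕ-injective; toℕ≤pred[n]; splitAt-join; suc-injective)
open import Data.Nat.Base as ℕ using (ℕ; zero; suc)
import Data.Nat.Properties as ℕ
open import Data.Product.Base using (Σ; _×_; _,_; proj₁; proj₂; ∃-syntax)
open import Data.Sum.Base using (_⊎_; inj₁; inj₂; map)
open import Data.Sum.Properties using (inj₁-injective; inj₂-injective)
open import Function.Base using (id; _∘_)
open import Relation.Binary.PropositionalEquality
open import Relation.Nullary using (¬_; Dec; does; yes; no; contradiction)
open import Relation.Nullary.Decidable using (¬?; _×-dec_)

-- A strong nesting of the complete graph: the colour of the edge {x , u} is the image of
-- that block, and the two axioms below say that the pairs {x , φ(A)} are distinct.
record NestingColouring (v w : ℕ) : Set where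
  field
    ι           : Fin v → Fin w
    ι-injective : ∀ {x y} → ι x ≡ ι y → x ≡ y
    colour      : Fin v → Fin v → Fin w
    symmetric   : ∀ x u → colour x u ≡ colour u x
    proper      : ∀ {x u u′} → x ≢ u → x ≢ u′ → colour x u ≡ colour x u′ → u ≡ u′
    asymmetric  : ∀ {x y u u′} → x ≢ u → y ≢ u′ → colour x u ≡ ι y → colour y u′ ≢ ι x

-- Linear arithmetic over the integers.

module IntegerConstruction where
  open import Data.Integer.Base using (ℤ; +_; -[1+_]; +0; +[1+_]; 0ℤ; 1ℤ; -1ℤ; _+_; _-_; _*_; -_; _≤_; +≤+)
  import Data.Integer.Properties as ℤ
  open import Data.Integer.Tactic.RingSolver
  open import Data.List.Base using ([]; _∷_)
  open import Data.Nat.Base using (NonZero)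
  open import Data.Nat.DivMod using (_mod_; _%_; _/_; m≡m%n+[m/n]*n; m%n<n)
  open import Algebra.Properties.Group (AbelianGroup.group ℤ.+-0-abelianGroup) using (∙-cancelʳ)

  -- An inequality between integers is kept as nonnegativity of a difference, so that deriving one
  -- means adding hypotheses with `_⊕_` and checking a ring identity.
  Nonneg : ℤ → Set
  Nonneg i = 0ℤ ≤ i

  _⊕_ : ∀ {i j} → Nonneg i → Nonneg j → Nonneg (i + j)
  _⊕_ = ℤ.+-mono-≤

  infixl 6 _⊕_
  infix  4 _≤⊎>_

  const : ∀ n → Nonneg (+ n)
  const n = +≤+ ℕ.z≤n

  -- A refutation in the style of Farkas: nonnegative hypotheses whose sum simplifies to -1.
  conflict : ∀ {i} {A : Set} → Nonneg i → i ≡ -1ℤ → A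
  conflict (+≤+ _) ()

  ≡⇒Nonneg : ∀ {i j} → i ≡ j → Nonneg (i - j)
  ≡⇒Nonneg {i} refl = ℤ.i≤j⇒0≤j-i {i} ℤ.≤-refl

  deduce : ∀ {i} j → Nonneg i → i ≡ j → Nonneg j
  deduce _ 0≤i i≡j = subst Nonneg i≡j 0≤i

  i-[1+j]≡i-j-1 : ∀ i j → i - (1ℤ + j) ≡ i - j - 1ℤ
  i-[1+j]≡i-j-1 = solve-∀

  _≤⊎>_ : ∀ i j → Nonneg (j - i) ⊎ Nonneg (i - j - 1ℤ)
  i ≤⊎> j with i ℤ.≤? j
  ... | yes i≤j = inj₁ (ℤ.i≤j⇒0≤j-i i≤j)
  ... | no  i≰j = inj₂ (deduce (i - j - 1ℤ) (ℤ.i≤j⇒0≤j-i (ℤ.i<j⇒suc[i]≤j (ℤ.≰⇒> i≰j))) (i-[1+j]≡i-j-1 i j))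

  i+j-j≡i : ∀ i j → i + j - j ≡ i
  i+j-j≡i = solve-∀

  i-j+j≡i : ∀ i j → i - j + j ≡ i
  i-j+j≡i = solve-∀

  -- Near edges: recovering a neighbour from a colour.

  -- Multiples of t are spelled as sums: under a with-abstraction a product + 3 * t unfolds and
  -- is no longer recognised by the ring solver.
  decode-low : ℤ → ℤ → ℤ → ℤ
  decode-low t x e with e ≤⊎> -1ℤ | e ℤ.≟ x
  ... | inj₁ _ | _     = e + (t + t + t + t + + 2)
  ... | inj₂ _ | yes _ = x + (1ℤ + (t + t + t))
  ... | inj₂ _ | no  _ = e

  -- For `x` above 3t the increment of 1 sends a neighbour `u` above 3t to `e = u + 1`. The value
  -- `e = x + 1` would belong to the loop `u = x`, so it is vacant and serves the neighbour at
  -- distance 3t + 1.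
  decode-high : ℤ → ℤ → ℤ → ℤ
  decode-high t x e with e ≤⊎> t + t + t | e ℤ.≟ x + 1ℤ | e ≤⊎> (t + t + t + t + 1ℤ)
  ... | inj₁ _ | _     | _      = e
  ... | inj₂ _ | yes _ | _      = x - (1ℤ + (t + t + t))
  ... | inj₂ _ | no  _ | inj₁ _ = e - 1ℤ
  ... | inj₂ _ | no  _ | inj₂ _ = e - (t + t + t + t + + 2)

  -- The neighbour of x reached by the colour ≡ x + e (mod 2t + 1), where x - t ≤ e ≤ x + t.
  decode : ℤ → ℤ → ℤ → ℤ
  decode t x e with x ≤⊎> (t - 1ℤ) | x ≤⊎> (t + t + t)
  ... | inj₁ _ | _      = decode-low t x e
  ... | inj₂ _ | inj₁ _ = e
  ... | inj₂ _ | inj₂ _ = decode-high t x e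

  -- A certificate that the colour x + u + s modulo 2t + 1 determines `u` once `x` is known: `e`
  -- represents u + s in the window of 2t + 1 consecutive integers centred at `x`, and `decode` is a
  -- left inverse.
  record Near (t x u s : ℤ) : Set where
    field
      e       : ℤ
      lower   : Nonneg (e - (x - t))
      upper   : Nonneg (x + t - e)
      decodes : decode t x e ≡ u
      k       : ℤ
      shifted : u + s ≡ e + k * (1ℤ + (t + t))

  module _ {t x u : ℤ} (0≤t : Nonneg t) (0≤x : Nonneg x) (0≤u : Nonneg u)
           (x≤4t : Nonneg ((t + t + t + t) - x)) (u≤4t : Nonneg ((t + t + t + t) - u)) where

    near-direct : x ≢ u → Nonneg (x + t - u) → Nonneg (u + t - x) →
                  Nonneg ((t + t + t) - x) ⊎ Nonneg ((t + t + t) - u) → Near t x u 0ℤ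
    near-direct x≢u u≤x+t x≤u+t middle = record
      { e = u ; k = 0ℤ
      ; lower   = deduce (u - (x - t)) x≤u+t (solve (t ∷ x ∷ u ∷ []))
      ; upper   = deduce (x + t - u) u≤x+t (solve (t ∷ x ∷ u ∷ []))
      ; decodes = decodes middle
      ; shifted = solve (t ∷ u ∷ [])
      }
      where
      decodes-low : decode-low t x u ≡ u
      decodes-low with u ≤⊎> -1ℤ | u ℤ.≟ x
      ... | inj₁ u<0 | _       = conflict (0≤u ⊕ u<0) (solve (u ∷ []))
      -- The value `e = x` is set aside for the neighbour at distance 3t + 1; only the loop would
      -- compete for it.
      ... | inj₂ _   | yes u≡x = contradiction (sym u≡x) x≢u
      ... | inj₂ _   | no  _   = refl

      decodes-high : Nonneg ((t + t + t) - u) → decode-high t x u ≡ u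
      decodes-high u≤3t with u ≤⊎> (t + t + t) | u ℤ.≟ x + 1ℤ | u ≤⊎> (t + t + t + t + 1ℤ)
      ... | inj₁ _    | _ | _ = refl
      ... | inj₂ 3t<u | _ | _ = conflict (u≤3t ⊕ 3t<u) (solve (t ∷ u ∷ []))

      decodes : Nonneg ((t + t + t) - x) ⊎ Nonneg ((t + t + t) - u) → decode t x u ≡ u
      decodes x∨u≤3t with x ≤⊎> (t - 1ℤ) | x ≤⊎> (t + t + t) | x∨u≤3t
      ... | inj₁ _ | _         | _         = decodes-low
      ... | inj₂ _ | inj₁ _    | _         = refl
      ... | inj₂ _ | inj₂ 3t<x | inj₁ x≤3t = conflict (x≤3t ⊕ 3t<x) (solve (t ∷ x ∷ []))
      ... | inj₂ _ | inj₂ _    | inj₂ u≤3t = decodes-high u≤3t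

    decode≡decode-low : Nonneg (t - 1ℤ - x) → ∀ e → decode t x e ≡ decode-low t x e
    decode≡decode-low x<t e with x ≤⊎> (t - 1ℤ) | x ≤⊎> (t + t + t)
    ... | inj₁ _   | _ = refl
    ... | inj₂ t≤x | _ = conflict (x<t ⊕ t≤x) (solve (t ∷ x ∷ []))

    decode≡decode-high : Nonneg (x - (t + t + t) - 1ℤ) → ∀ e → decode t x e ≡ decode-high t x e
    decode≡decode-high 3t<x e with x ≤⊎> (t - 1ℤ) | x ≤⊎> (t + t + t)
    ... | inj₂ _   | inj₂ _    = refl
    ... | inj₂ _   | inj₁ x≤3t = conflict (x≤3t ⊕ 3t<x) (solve (t ∷ x ∷ []))
    ... | inj₁ x<t | _         = conflict (x<t ⊕ 3t<x ⊕ 0≤t ⊕ 0≤t ⊕ const 1) (solve (t ∷ x ∷ []))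

    -- Increasing the colour by 1 moves the vacancy left by the loop from `x` to `x + 1`, where the
    -- edge of length 3t + 1 needs it when seen from its larger end.
    near-top : x ≢ u → Nonneg (x - (t + t + t) - 1ℤ) → Nonneg (u - (t + t + t) - 1ℤ) → Near t x u 1ℤ
    near-top x≢u 3t<x 3t<u = record
      { e = u + 1ℤ ; k = 0ℤ
      ; lower   = deduce (u + 1ℤ - (x - t)) (3t<u ⊕ x≤4t ⊕ const 2) (solve (t ∷ x ∷ u ∷ []))
      ; upper   = deduce (x + t - (u + 1ℤ)) (3t<x ⊕ u≤4t) (solve (t ∷ x ∷ u ∷ []))
      ; decodes = trans (decode≡decode-high 3t<x (u + 1ℤ)) decodes
      ; shifted = solve (t ∷ u ∷ [])
      }
      where
      decodes : decode-high t x (u + 1ℤ) ≡ u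
      decodes with u + 1ℤ ≤⊎> (t + t + t) | u + 1ℤ ℤ.≟ x + 1ℤ | u + 1ℤ ≤⊎> (t + t + t + t + 1ℤ)
      ... | inj₁ u<3t | _       | _         = conflict (3t<u ⊕ u<3t ⊕ const 1) (solve (t ∷ u ∷ []))
      ... | inj₂ _    | yes u≡x | _         = contradiction (sym (∙-cancelʳ 1ℤ u x u≡x)) x≢u
      ... | inj₂ _    | no  _   | inj₁ _    = i+j-j≡i u 1ℤ
      ... | inj₂ _    | no  _   | inj₂ 4t<u = conflict (u≤4t ⊕ 4t<u) (solve (t ∷ u ∷ []))

    -- The shift 4t + 2 is twice the modulus. Length 3t + 1 is left out because its representative
    -- would fall one step outside the window.
    near-wrap-up : Nonneg (u - x - (t + t + t) - + 2) → Near t x u 0ℤ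
    near-wrap-up gap = record
      { e = u - (t + t + t + t + + 2) ; k = + 2
      ; lower   = deduce (u - (t + t + t + t + + 2) - (x - t)) gap (solve (t ∷ x ∷ u ∷ []))
      ; upper   = deduce (x + t - (u - (t + t + t + t + + 2))) (u≤4t ⊕ 0≤x ⊕ 0≤t ⊕ const 2) (solve (t ∷ x ∷ u ∷ []))
      ; decodes = trans (decode≡decode-low x<t _) decodes
      ; shifted = solve (t ∷ u ∷ [])
      }
      where
      x<t : Nonneg (t - 1ℤ - x)
      x<t = deduce (t - 1ℤ - x) (gap ⊕ u≤4t ⊕ const 1) (solve (t ∷ x ∷ u ∷ []))

      decodes : decode-low t x (u - (t + t + t + t + + 2)) ≡ u
      decodes with u - (t + t + t + t + + 2) ≤⊎> -1ℤ | u - (t + t + t + t + + 2) ℤ.≟ x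
      ... | inj₁ _   | _ = i-j+j≡i u _
      ... | inj₂ 0≤e | _ = conflict (u≤4t ⊕ 0≤e ⊕ const 1) (solve (t ∷ u ∷ []))

    near-wrap-down : Nonneg (x - u - (t + t + t) - + 2) → Near t x u 0ℤ
    near-wrap-down gap = record
      { e = u + (t + t + t + t + + 2) ; k = - + 2
      ; lower   = deduce (u + (t + t + t + t + + 2) - (x - t)) (x≤4t ⊕ 0≤u ⊕ 0≤t ⊕ const 2) (solve (t ∷ x ∷ u ∷ []))
      ; upper   = deduce (x + t - (u + (t + t + t + t + + 2))) gap (solve (t ∷ x ∷ u ∷ []))
      ; decodes = trans (decode≡decode-high 3t<x _) decodes
      ; shifted = solve (t ∷ u ∷ [])
      }
      where
      3t<x : Nonneg (x - (t + t + t) - 1ℤ)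
      3t<x = deduce (x - (t + t + t) - 1ℤ) (gap ⊕ 0≤u ⊕ const 1) (solve (t ∷ x ∷ u ∷ []))

      decodes : decode-high t x (u + (t + t + t + t + + 2)) ≡ u
      decodes with u + (t + t + t + t + + 2) ≤⊎> (t + t + t)
                 | u + (t + t + t + t + + 2) ℤ.≟ x + 1ℤ
                 | u + (t + t + t + t + + 2) ≤⊎> (t + t + t + t + 1ℤ)
      ... | inj₁ e≤3t | _      | _       = conflict (e≤3t ⊕ 0≤u ⊕ 0≤t ⊕ const 1) (solve (t ∷ u ∷ []))
      ... | inj₂ _    | yes e≡ | _       = conflict (x≤4t ⊕ 0≤u ⊕ ≡⇒Nonneg (sym e≡)) (solve (t ∷ x ∷ u ∷ []))
      ... | inj₂ _    | no  _  | inj₁ e≤ = conflict (e≤ ⊕ 0≤u) (solve (t ∷ u ∷ []))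
      ... | inj₂ _    | no  _  | inj₂ _  = i+j-j≡i u _

    -- Since (3t + 1) + (t + 1) = 2 (2t + 1), the correction t + 1 brings the representative to `x`
    -- itself, the place vacated by the loop.
    near-diagonal-up : u ≡ x + (1ℤ + (t + t + t)) → Near t x u (1ℤ + t)
    near-diagonal-up refl = record
      { e = x ; k = + 2
      ; lower   = deduce (x - (x - t)) 0≤t (solve (t ∷ x ∷ []))
      ; upper   = deduce (x + t - x) 0≤t (solve (t ∷ x ∷ []))
      ; decodes = trans (decode≡decode-low (deduce (t - 1ℤ - x) u≤4t (solve (t ∷ x ∷ []))) x) decodes
      ; shifted = solve (t ∷ x ∷ [])
      }
      where
      decodes : decode-low t x x ≡ u
      decodes with x ≤⊎> -1ℤ | x ℤ.≟ x
      ... | inj₁ x<0 | _       = conflict (0≤x ⊕ x<0) (solve (x ∷ []))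
      ... | inj₂ _   | yes _   = refl
      ... | inj₂ _   | no  x≢x = contradiction refl x≢x

    -- From the larger end the same correction gives u + t + 1 = (x + 1) - (2t + 1), so the
    -- representative is the vacancy `x + 1`.
    near-diagonal-down : x ≡ u + (1ℤ + (t + t + t)) → Near t x u (1ℤ + t)
    near-diagonal-down refl = record
      { e = x + 1ℤ ; k = - 1ℤ
      ; lower   = deduce (x + 1ℤ - (x - t)) (0≤t ⊕ const 1) (solve (t ∷ u ∷ []))
      ; upper   = deduce (x + t - (x + 1ℤ)) (x≤4t ⊕ 0≤u) (solve (t ∷ u ∷ []))
      ; decodes = trans (decode≡decode-high (deduce (x - (t + t + t) - 1ℤ) 0≤u (solve (t ∷ u ∷ []))) (x + 1ℤ)) decodes
      ; shifted = solve (t ∷ u ∷ [])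
      }
      where
      decodes : decode-high t x (x + 1ℤ) ≡ u
      decodes with x + 1ℤ ≤⊎> (t + t + t) | x + 1ℤ ℤ.≟ x + 1ℤ | x + 1ℤ ≤⊎> (t + t + t + t + 1ℤ)
      ... | inj₁ e≤3t | _       | _ = conflict (0≤u ⊕ e≤3t ⊕ const 1) (solve (t ∷ u ∷ []))
      ... | inj₂ _    | yes _   | _ = i+j-j≡i u _
      ... | inj₂ _    | no  e≢e | _ = contradiction refl e≢e

  -- Congruences between natural numbers.

  ≤⇒Nonneg : ∀ {m n} → m ℕ.≤ n → Nonneg (+ n - + m)
  ≤⇒Nonneg m≤n = ℤ.i≤j⇒0≤j-i (+≤+ m≤n)

  <⇒Nonneg : ∀ {m n} → m ℕ.< n → Nonneg (+ n - + m - 1ℤ)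
  <⇒Nonneg {m} {n} m<n = deduce (+ n - + m - 1ℤ) (≤⇒Nonneg m<n) (i-[1+j]≡i-j-1 (+ n) (+ m))

  mod-≡⇒∣ : ∀ m n d .{{_ : NonZero d}} → m mod d ≡ n mod d → ∃[ k ] + m - + n ≡ k * + d
  mod-≡⇒∣ m n d eq = + (m / d) - + (n / d) , (begin
    + m - + n
      ≡⟨ cong₂ _-_ (divMod m) (divMod n) ⟩
    + (m % d) + + (m / d) * + d - (+ (n % d) + + (n / d) * + d)
      ≡⟨ cong (λ r → + r + + (m / d) * + d - (+ (n % d) + + (n / d) * + d)) %-≡ ⟩
    + (n % d) + + (m / d) * + d - (+ (n % d) + + (n / d) * + d)
      ≡⟨ cancel (+ (n % d)) (+ (m / d)) (+ (n / d)) (+ d) ⟩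
    (+ (m / d) - + (n / d)) * + d ∎)
    where
    open ≡-Reasoning
    divMod : ∀ m → + m ≡ + (m % d) + + (m / d) * + d
    divMod m = trans (cong +_ (m≡m%n+[m/n]*n m d)) (cong (λ i → + (m % d) + i) (ℤ.pos-* (m / d) d))
    %-≡ : m % d ≡ n % d
    %-≡ = trans (sym (toℕ-fromℕ< (m%n<n m d))) (trans (cong toℕ eq) (toℕ-fromℕ< (m%n<n n d)))
    cancel : ∀ r p q d → r + p * d - (r + q * d) ≡ (p - q) * d
    cancel = solve-∀

  -- For nonzero `k` of absolute value 1 + n, adding n * d to the bound that fails gives -1.
  small-multiple : ∀ {i} k d → i ≡ k * + d → Nonneg (i + + d - 1ℤ) → Nonneg (+ d - 1ℤ - i) → i ≡ 0ℤ
  small-multiple +0 d eq _ _ = eq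
  small-multiple +[1+ n ] d refl _ i<d =
    conflict (i<d ⊕ deduce (+ n * + d) (const (n ℕ.* d)) (ℤ.pos-* n d)) (excess (+ n) (+ d))
    where
    excess : ∀ n d → d - 1ℤ - (1ℤ + n) * d + n * d ≡ -1ℤ
    excess = solve-∀
  small-multiple -[1+ n ] d refl -d<i _ =
    conflict (-d<i ⊕ deduce (+ n * + d) (const (n ℕ.* d)) (ℤ.pos-* n d)) (excess (+ n) (+ d))
    where
    excess : ∀ n d → - (1ℤ + n) * d + d - 1ℤ + n * d ≡ -1ℤ
    excess = solve-∀

  -- The two representatives are congruent modulo 2t + 1 and share a window of that length, so they
  -- coincide and decode to the same neighbour.
  near-unique : ∀ {t x u u′ s s′} k → Near (+ t) x u s → Near (+ t) x u′ s′ →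
                (x + u + s) - (x + u′ + s′) ≡ k * + suc (t ℕ.+ t) → u ≡ u′
  near-unique {t} {x} {u} {u′} {s} {s′} k near near′ eq =
    trans (sym N.decodes) (trans (cong (decode (+ t) x) e≡e′) N′.decodes)
    where
    module N = Near near
    module N′ = Near near′
    modulus = + suc (t ℕ.+ t)

    regroup : ∀ e e′ k k′ d → e - e′ ≡ (e + k * d) - (e′ + k′ * d) - (k - k′) * d
    regroup = solve-∀
    regroup′ : ∀ x u u′ s s′ → (u + s) - (u′ + s′) ≡ (x + u + s) - (x + u′ + s′)
    regroup′ = solve-∀
    factor : ∀ k l l′ d → k * d - (l - l′) * d ≡ (k - (l - l′)) * d
    factor = solve-∀
    below : ∀ t x e e′ → (e - (x - t)) + (x + t - e′) ≡ e - e′ + (1ℤ + (t + t)) - 1ℤ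
    below = solve-∀
    above : ∀ t x e e′ → (x + t - e) + (e′ - (x - t)) ≡ (1ℤ + (t + t)) - 1ℤ - (e - e′)
    above = solve-∀
    open ≡-Reasoning

    e≡e′ : N.e ≡ N′.e
    e≡e′ = ℤ.i-j≡0⇒i≡j N.e N′.e (small-multiple (k - (N.k - N′.k)) (suc (t ℕ.+ t)) (begin
      N.e - N′.e
        ≡⟨ regroup N.e N′.e N.k N′.k modulus ⟩
      (N.e + N.k * modulus) - (N′.e + N′.k * modulus) - (N.k - N′.k) * modulus
        ≡⟨ cong (_- (N.k - N′.k) * modulus) (cong₂ _-_ (sym N.shifted) (sym N′.shifted)) ⟩
      (u + s) - (u′ + s′) - (N.k - N′.k) * modulus
        ≡⟨ cong (_- (N.k - N′.k) * modulus) (trans (regroup′ x u u′ s s′) eq) ⟩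
      k * modulus - (N.k - N′.k) * modulus
        ≡⟨ factor k N.k N′.k modulus ⟩
      (k - (N.k - N′.k)) * modulus ∎)
      (deduce (N.e - N′.e + modulus - 1ℤ) (N.lower ⊕ N′.upper) (below (+ t) x N.e N′.e))
      (deduce (modulus - 1ℤ - (N.e - N′.e)) (N.upper ⊕ N′.lower) (above (+ t) x N.e N′.e)))

  -- The cyclic colouring of the complete graph.

  module Construction (t : ℕ) where
    2t+1 3t 4t 4t+1 : ℕ
    3t = t ℕ.+ t ℕ.+ t
    4t = 3t ℕ.+ t
    2t+1 = suc (t ℕ.+ t)
    4t+1 = suc 4t

    Hue : Set
    Hue = Fin 4t+1 ⊎ Fin 2t+1

    top : ℕ → ℕ
    top l with 3t ℕ.<? l
    ... | yes _ = 1
    ... | no  _ = 0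

    diagonal : ℕ → ℕ
    diagonal d with d ℕ.≟ suc 3t
    ... | yes _ = suc t
    ... | no  _ = 0

    -- The hue of an edge at distance d whose smaller end is l and whose ends have sum s.
    palette : ℕ → ℕ → ℕ → Hue
    palette d l s with d ℕ.≤? t | d ℕ.≤? 3t
    ... | yes _ | _     = inj₂ ((s ℕ.+ top l) mod 2t+1)
    ... | no  _ | yes _ = inj₁ (s mod 4t+1)
    ... | no  _ | no  _ = inj₂ ((s ℕ.+ diagonal d) mod 2t+1)

    -- Only the distance, the minimum and the sum of the ends enter, which makes symmetry immediate.
    hue : ℕ → ℕ → Hue
    hue x u = palette ℕ.∣ x - u ∣ (x ℕ.⊓ u) (x ℕ.+ u)

    -- Naming the point y by 2y + t, rather than letting the colour of a far edge be the half
    -- of x + u - t, avoids dividing by 2 modulo 4t + 1.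
    label : ℕ → Fin 4t+1
    label y = (y ℕ.+ y ℕ.+ t) mod 4t+1

    -- An edge seen from its end `x`: each hue is paired with the arithmetic evidence for its kind,
    -- so that later arguments need not repeat the case split of `palette`.
    data Shape (x u : ℕ) : Hue → Set where
      near : ∀ s → Near (+ t) (+ x) (+ u) (+ s) → Shape x u (inj₂ ((x ℕ.+ u ℕ.+ s) mod 2t+1))
      -- D is the residue of u - x modulo 4t + 1.
      far  : ∀ D ε → + u ≡ + x + D - ε * + 4t+1 → Nonneg (D - + t - 1ℤ) → Nonneg (+ 3t - D) →
             Shape x u (inj₁ ((x ℕ.+ u) mod 4t+1))

    distance : ∀ x u → u ≡ x ℕ.+ ℕ.∣ x - u ∣ ⊎ x ≡ u ℕ.+ ℕ.∣ x - u ∣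
    distance x u with ℕ.≤-total x u
    ... | inj₁ x≤u = inj₁ (sym (trans (cong (x ℕ.+_) (ℕ.m≤n⇒∣m-n∣≡n∸m x≤u)) (ℕ.m+[n∸m]≡n x≤u)))
    ... | inj₂ u≤x = inj₂ (sym (trans (cong (u ℕ.+_) (trans (ℕ.∣-∣-comm x u) (ℕ.m≤n⇒∣m-n∣≡n∸m u≤x))) (ℕ.m+[n∸m]≡n u≤x)))

    gap : ∀ {x d} → suc 3t ℕ.< d → Nonneg (+ (x ℕ.+ d) - + x - + 3t - + 2)
    gap {x} {d} 3t+1<d = deduce _ (≤⇒Nonneg 3t+1<d) (shift (+ 3t) (+ x) (+ d))
      where
      shift : ∀ s x d → d - (+ 2 + s) ≡ x + d - x - s - + 2
      shift = solve-∀

    module _ {x u : ℕ} (x≤4t : x ℕ.≤ 4t) (u≤4t : u ℕ.≤ 4t) where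
      private
        0≤4t-x = ≤⇒Nonneg x≤4t
        0≤4t-u = ≤⇒Nonneg u≤4t

      near-shape : x ≢ u → ℕ.∣ x - u ∣ ℕ.≤ t →
                   Shape x u (inj₂ ((x ℕ.+ u ℕ.+ top (x ℕ.⊓ u)) mod 2t+1))
      near-shape x≢u d≤t with 3t ℕ.<? x ℕ.⊓ u
      ... | yes 3t<x⊓u = near 1 (near-top (const t) (const x) (const u) 0≤4t-x 0≤4t-u
                           (λ { refl → x≢u refl })
                           (<⇒Nonneg (ℕ.m≤n⊓o⇒m≤n x u 3t<x⊓u))
                           (<⇒Nonneg (ℕ.m≤n⊓o⇒m≤o x u 3t<x⊓u)))
      ... | no  3t≮x⊓u = near 0 (near-direct (const t) (const x) (const u) 0≤4t-x 0≤4t-u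
                           (λ { refl → x≢u refl })
                           (≤⇒Nonneg (ℕ.≤-trans (ℕ.m≤n+∣n-m∣ u x) (ℕ.+-monoʳ-≤ x d≤t)))
                           (≤⇒Nonneg (ℕ.≤-trans (ℕ.m≤n+∣m-n∣ x u) (ℕ.+-monoʳ-≤ u d≤t)))
                           (middle (ℕ.⊓-sel x u)))
        where
        middle : x ℕ.⊓ u ≡ x ⊎ x ℕ.⊓ u ≡ u → Nonneg (+ 3t - + x) ⊎ Nonneg (+ 3t - + u)
        middle (inj₁ ⊓≡x) = inj₁ (≤⇒Nonneg (subst (ℕ._≤ 3t) ⊓≡x (ℕ.≮⇒≥ 3t≮x⊓u)))
        middle (inj₂ ⊓≡u) = inj₂ (≤⇒Nonneg (subst (ℕ._≤ 3t) ⊓≡u (ℕ.≮⇒≥ 3t≮x⊓u)))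

      far-shape : ∀ d → u ≡ x ℕ.+ d ⊎ x ≡ u ℕ.+ d → t ℕ.< d → d ℕ.≤ 3t → Shape x u (inj₁ ((x ℕ.+ u) mod 4t+1))
      far-shape d (inj₁ refl) t<d d≤3t = far (+ d) 0ℤ (eq (+ x) (+ d) (+ 4t+1))
        (<⇒Nonneg t<d) (≤⇒Nonneg d≤3t)
        where
        eq : ∀ x d v → x + d ≡ x + d - 0ℤ * v
        eq = solve-∀
      -- Reversing the orientation replaces d by 4t + 1 - d, which maps the interval from t + 1 to
      -- 3t to itself.
      far-shape d (inj₂ refl) t<d d≤3t = far (+ 4t+1 - + d) 1ℤ (eq (+ u) (+ d) (+ 4t+1))
        (deduce _ (≤⇒Nonneg d≤3t) (low (+ t) (+ d))) (deduce _ (≤⇒Nonneg t<d) (high (+ t) (+ d)))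
        where
        eq : ∀ u d v → u ≡ u + d + (v - d) - 1ℤ * v
        eq = solve-∀
        low : ∀ t d → t + t + t - d ≡ 1ℤ + (t + t + t + t) - d - t - 1ℤ
        low = solve-∀
        high : ∀ t d → d - (1ℤ + t) ≡ t + t + t - (1ℤ + (t + t + t + t) - d)
        high = solve-∀

      wrap-shape : ∀ d → u ≡ x ℕ.+ d ⊎ x ≡ u ℕ.+ d → 3t ℕ.< d →
                   Shape x u (inj₂ ((x ℕ.+ u ℕ.+ diagonal d) mod 2t+1))
      wrap-shape d order 3t<d with d ℕ.≟ suc 3t | order
      ... | yes refl | inj₁ eq = near (suc t) (near-diagonal-up (const t) (const x) (const u) 0≤4t-x 0≤4t-u (cong +_ eq))
      ... | yes refl | inj₂ eq = near (suc t) (near-diagonal-down (const t) (const x) (const u) 0≤4t-x 0≤4t-u (cong +_ eq))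
      ... | no  d≢   | inj₁ refl = near 0 (near-wrap-up (const t) (const x) (const u) 0≤4t-x 0≤4t-u
                                     (gap {x} (ℕ.≤∧≢⇒< 3t<d (d≢ ∘ sym))))
      ... | no  d≢   | inj₂ refl = near 0 (near-wrap-down (const t) (const x) (const u) 0≤4t-x 0≤4t-u
                                     (gap {u} (ℕ.≤∧≢⇒< 3t<d (d≢ ∘ sym))))

      hue-shape : x ≢ u → Shape x u (hue x u)
      hue-shape x≢u with ℕ.∣ x - u ∣ ℕ.≤? t | ℕ.∣ x - u ∣ ℕ.≤? 3t
      ... | yes d≤t | _        = near-shape x≢u d≤t
      ... | no  d≰t | yes d≤3t = far-shape _ (distance x u) (ℕ.≰⇒> d≰t) d≤3t
      ... | no  _   | no  d≰3t = wrap-shape _ (distance x u) (ℕ.≰⇒> d≰3t)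

    4t-small : ∀ {m n} k → m ℕ.≤ 4t → n ℕ.≤ 4t → + m - + n ≡ k * + 4t+1 → m ≡ n
    4t-small {m} {n} k m≤4t n≤4t eq = ℤ.+-injective (ℤ.i-j≡0⇒i≡j (+ m) (+ n) (small-multiple k 4t+1 eq
      (deduce _ (const m ⊕ ≤⇒Nonneg n≤4t) (below (+ m) (+ n) (+ 4t)))
      (deduce _ (≤⇒Nonneg m≤4t ⊕ const n) (above (+ m) (+ n) (+ 4t)))))
      where
      below : ∀ m n s → m + (s - n) ≡ m - n + (1ℤ + s) - 1ℤ
      below = solve-∀
      above : ∀ m n s → s - m + n ≡ 1ℤ + s - 1ℤ - (m - n)
      above = solve-∀

    shape-proper : ∀ {x u u′ c c′} → u ℕ.≤ 4t → u′ ℕ.≤ 4t → Shape x u c → Shape x u′ c′ → c ≡ c′ → u ≡ u′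
    shape-proper {x} {u} {u′} _ _ (near s n) (near s′ n′) eq
      with k , x+u≡ ← mod-≡⇒∣ (x ℕ.+ u ℕ.+ s) (x ℕ.+ u′ ℕ.+ s′) 2t+1 (inj₂-injective eq) =
      ℤ.+-injective (near-unique k n n′ x+u≡)
    shape-proper {x} {u} {u′} u≤ u′≤ (far _ _ _ _ _) (far _ _ _ _ _) eq
      with k , x+u≡ ← mod-≡⇒∣ (x ℕ.+ u) (x ℕ.+ u′) 4t+1 (inj₁-injective eq) =
      4t-small k u≤ u′≤ (trans (cancel (+ x) (+ u) (+ u′)) x+u≡)
      where
      cancel : ∀ x u u′ → u - u′ ≡ (x + u) - (x + u′)
      cancel = solve-∀
    shape-proper _ _ (near _ _) (far _ _ _ _ _) ()
    shape-proper _ _ (far _ _ _ _ _) (near _ _) ()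

    -- Write u = x + D and u′ = y + D′ modulo 4t + 1. Adding x + u = 2y + t and y + u′ = 2x + t
    -- gives D + D′ = 2t modulo 4t + 1. As D and D′ lie between t + 1 and 3t, the difference D + D′
    -- - 2t lies between 2 and 4t, which is impossible.
    shape-asymmetric : ∀ {x y u u′ c c′} → Shape x u c → Shape y u′ c′ → c ≡ inj₁ (label y) → c′ ≢ inj₁ (label x)
    shape-asymmetric {x} {y} {u} {u′} (far D ε u≡ t<D D≤3t) (far D′ ε′ u′≡ t<D′ D′≤3t) eq eq′
      with k , p ← mod-≡⇒∣ (x ℕ.+ u) (y ℕ.+ y ℕ.+ t) 4t+1 (inj₁-injective eq)
         | k′ , p′ ← mod-≡⇒∣ (y ℕ.+ u′) (x ℕ.+ x ℕ.+ t) 4t+1 (inj₁-injective eq′)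
      = conflict (t<D ⊕ t<D′ ⊕ ≡⇒Nonneg (sym D+D′≡2t) ⊕ const 1) (final (+ t) D D′)
      where
      regroup : ∀ t x y D D′ ε ε′ v → D + D′ - (t + t) ≡
                (x + (x + D - ε * v) - (y + y + t)) + (y + (y + D′ - ε′ * v) - (x + x + t)) + (ε + ε′) * v
      regroup = solve-∀
      factor : ∀ k k′ ε v → k * v + k′ * v + ε * v ≡ (k + k′ + ε) * v
      factor = solve-∀
      below : ∀ t D D′ → (D - t - 1ℤ) + (D′ - t - 1ℤ) + (t + t + t + t) + + 2 ≡
              D + D′ - (t + t) + (1ℤ + (t + t + t + t)) - 1ℤ
      below = solve-∀
      above : ∀ t D D′ → (t + t + t - D) + (t + t + t - D′) ≡ 1ℤ + (t + t + t + t) - 1ℤ - (D + D′ - (t + t))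
      above = solve-∀
      final : ∀ t D D′ → (D - t - 1ℤ) + (D′ - t - 1ℤ) + (0ℤ - (D + D′ - (t + t))) + 1ℤ ≡ -1ℤ
      final = solve-∀
      open ≡-Reasoning

      D+D′≡2t : D + D′ - (+ t + + t) ≡ 0ℤ
      D+D′≡2t = small-multiple (k + k′ + (ε + ε′)) 4t+1 (begin
        D + D′ - (+ t + + t)
          ≡⟨ regroup (+ t) (+ x) (+ y) D D′ ε ε′ (+ 4t+1) ⟩
        (+ x + (+ x + D - ε * + 4t+1) - + (y ℕ.+ y ℕ.+ t))
          + (+ y + (+ y + D′ - ε′ * + 4t+1) - + (x ℕ.+ x ℕ.+ t)) + (ε + ε′) * + 4t+1
          ≡⟨ cong₂ (λ a b → (+ x + a - + (y ℕ.+ y ℕ.+ t)) + (+ y + b - + (x ℕ.+ x ℕ.+ t)) + (ε + ε′) * + 4t+1)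
                   (sym u≡) (sym u′≡) ⟩
        (+ (x ℕ.+ u) - + (y ℕ.+ y ℕ.+ t)) + (+ (y ℕ.+ u′) - + (x ℕ.+ x ℕ.+ t)) + (ε + ε′) * + 4t+1
          ≡⟨ cong₂ (λ a b → a + b + (ε + ε′) * + 4t+1) p p′ ⟩
        k * + 4t+1 + k′ * + 4t+1 + (ε + ε′) * + 4t+1
          ≡⟨ factor k k′ (ε + ε′) (+ 4t+1) ⟩
        (k + k′ + (ε + ε′)) * + 4t+1 ∎)
        (deduce _ (t<D ⊕ t<D′ ⊕ const 4t ⊕ const 2) (below (+ t) D D′))
        (deduce _ (D≤3t ⊕ D′≤3t) (above (+ t) D D′))
    shape-asymmetric (near _ _) _ ()
    shape-asymmetric (far _ _ _ _ _) (near _ _) _ ()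

    label-injective : ∀ {x y} → x ℕ.≤ 4t → y ℕ.≤ 4t → label x ≡ label y → x ≡ y
    label-injective {x} {y} x≤ y≤ eq with k , p ← mod-≡⇒∣ (x ℕ.+ x ℕ.+ t) (y ℕ.+ y ℕ.+ t) 4t+1 eq =
      4t-small (k * (1ℤ + (+ t + + t)) - (+ x - + y)) x≤ y≤
        (trans (halve (+ t) (+ x) (+ y)) (trans (cong (λ a → a * (1ℤ + (+ t + + t)) - (+ x - + y) * + 4t+1) p)
          (factor k (1ℤ + (+ t + + t)) (+ x - + y) (+ 4t+1))))
      where
      -- 2 (2t + 1) = (4t + 1) + 1, so 2t + 1 inverts 2 modulo 4t + 1.
      halve : ∀ t x y → x - y ≡ ((x + x + t) - (y + y + t)) * (1ℤ + (t + t)) - (x - y) * (1ℤ + (t + t + t + t))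
      halve = solve-∀
      factor : ∀ k a b v → k * v * a - b * v ≡ (k * a - b) * v
      factor = solve-∀

    nestingColouring : NestingColouring 4t+1 (4t+1 ℕ.+ 2t+1)
    nestingColouring = record
      { ι           = λ x → encode (inj₁ (label (toℕ x)))
      ; ι-injective = λ {x} {y} eq → toℕ-injective (label-injective (toℕ≤pred[n] x) (toℕ≤pred[n] y)
                                       (inj₁-injective (encode-injective eq)))
      ; colour      = λ x u → encode (hue (toℕ x) (toℕ u))
      ; symmetric   = λ x u → cong encode (hue-symmetric (toℕ x) (toℕ u))
      ; proper      = λ {x} {u} {u′} x≢u x≢u′ eq → toℕ-injective (shape-proper (toℕ≤pred[n] u) (toℕ≤pred[n] u′)
                        (shape x≢u) (shape x≢u′) (encode-injective eq))
      ; asymmetric  = λ x≢u y≢u′ eq eq′ → shape-asymmetric (shape x≢u) (shape y≢u′)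
                        (encode-injective eq) (encode-injective eq′)
      }
      where
      encode : Hue → Fin (4t+1 ℕ.+ 2t+1)
      encode = join 4t+1 2t+1

      encode-injective : ∀ {c c′} → encode c ≡ encode c′ → c ≡ c′
      encode-injective {c} {c′} eq = trans (sym (splitAt-join 4t+1 2t+1 c))
        (trans (cong (splitAt 4t+1) eq) (splitAt-join 4t+1 2t+1 c′))

      hue-symmetric : ∀ x u → hue x u ≡ hue u x
      hue-symmetric x u rewrite ℕ.∣-∣-comm x u | ℕ.⊓-comm x u | ℕ.+-comm x u = refl

      shape : ∀ {x u : Fin 4t+1} → x ≢ u → Shape (toℕ x) (toℕ u) (hue (toℕ x) (toℕ u))
      shape {x} {u} x≢u = hue-shape (toℕ≤pred[n] x) (toℕ≤pred[n] u) (λ eq → x≢u (toℕ-injective eq))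

-- Strong nestings as edge colourings.

open IntegerConstruction using (module Construction)
open import Data.Fin.Subset using (Subset; inside; outside; ⊥; _∈_; ∣_∣; ⁅_⁆; _∪_)
open import Data.Fin.Subset.Properties using (∪-identityˡ; ∪-comm; x∈⁅x⁆; x∈⁅y⁆⇒x≡y; x∈p∪q⁺; x∈p∪q⁻)
open import Data.List.Base using (List; _∷_; lookup)
open import Data.List.Membership.Propositional using () renaming (_∈_ to _∈ᴸ_)
open import Data.List.Membership.Propositional.Properties using (∈-filter⁺; ∈-lookup)
open import Data.List.Relation.Unary.All as All using ()
open import Data.List.Relation.Unary.AllPairs using (_∷_)
open import Data.List.Relation.Unary.Any using (index)
open import Data.List.Relation.Unary.Any.Properties using (lookup-index)
open import Data.List.Relation.Unary.Unique.Propositional using (Unique)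
import Data.List.Relation.Unary.Unique.Propositional.Properties as Unique
open import Data.Vec.Base using ([]; _∷_)
open import Function.Bundles using (Injection; mk↣)

lookup-injective : ∀ {A : Set} {as : List A} → Unique as → ∀ {i j} → lookup as i ≡ lookup as j → i ≡ j
lookup-injective (_ ∷ _)  {zero}  {zero}  _  = refl
lookup-injective (a∉ ∷ _) {zero}  {suc j} eq = contradiction eq (All.lookup a∉ (∈-lookup j))
lookup-injective (a∉ ∷ _) {suc i} {zero}  eq = contradiction (sym eq) (All.lookup a∉ (∈-lookup i))
lookup-injective (_ ∷ u)  {suc i} {suc j} eq = cong suc (lookup-injective u eq)

module _ {n : ℕ} where

  x∈⁅x⁆∪⁅y⁆ : ∀ (x y : Fin n) → x ∈ ⁅ x ⁆ ∪ ⁅ y ⁆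
  x∈⁅x⁆∪⁅y⁆ x y = x∈p∪q⁺ (inj₁ (x∈⁅x⁆ x))

  y∈⁅x⁆∪⁅y⁆ : ∀ (x y : Fin n) → y ∈ ⁅ x ⁆ ∪ ⁅ y ⁆
  y∈⁅x⁆∪⁅y⁆ x y = x∈p∪q⁺ (inj₂ (x∈⁅x⁆ y))

  ∈⁅x⁆∪⁅y⁆⁻ : ∀ (x y : Fin n) {z} → z ∈ ⁅ x ⁆ ∪ ⁅ y ⁆ → z ≡ x ⊎ z ≡ y
  ∈⁅x⁆∪⁅y⁆⁻ x y = map (x∈⁅y⁆⇒x≡y x) (x∈⁅y⁆⇒x≡y y) ∘ x∈p∪q⁻ ⁅ x ⁆ ⁅ y ⁆

  -- The pairs may be degenerate: `x` and `y` can both land on the same one of `x′` and `y′`, and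
  -- then the reverse inclusion settles the other equation.
  ⁅x⁆∪⁅y⁆-injective : ∀ {x y x′ y′ : Fin n} → ⁅ x ⁆ ∪ ⁅ y ⁆ ≡ ⁅ x′ ⁆ ∪ ⁅ y′ ⁆ →
                      (x ≡ x′ × y ≡ y′) ⊎ (x ≡ y′ × y ≡ x′)
  ⁅x⁆∪⁅y⁆-injective {x} {y} {x′} {y′} eq
    with ∈⁅x⁆∪⁅y⁆⁻ x′ y′ (subst (x ∈_) eq (x∈⁅x⁆∪⁅y⁆ x y))
       | ∈⁅x⁆∪⁅y⁆⁻ x′ y′ (subst (y ∈_) eq (y∈⁅x⁆∪⁅y⁆ x y))
       | ∈⁅x⁆∪⁅y⁆⁻ x y (subst (x′ ∈_) (sym eq) (x∈⁅x⁆∪⁅y⁆ x′ y′))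
       | ∈⁅x⁆∪⁅y⁆⁻ x y (subst (y′ ∈_) (sym eq) (y∈⁅x⁆∪⁅y⁆ x′ y′))
  ... | inj₁ p | inj₂ q | _      | _      = inj₁ (p , q)
  ... | inj₂ p | inj₁ q | _      | _      = inj₂ (p , q)
  ... | inj₁ p | inj₁ q | _      | inj₁ s = inj₂ (sym s , q)
  ... | inj₁ p | inj₁ q | _      | inj₂ s = inj₁ (p , sym s)
  ... | inj₂ p | inj₂ q | inj₁ r | _      = inj₁ (sym r , q)
  ... | inj₂ p | inj₂ q | inj₂ r | _      = inj₂ (p , sym r)

∣p∣≡0⇒p≡⊥ : ∀ {n} (p : Subset n) → ∣ p ∣ ≡ 0 → p ≡ ⊥
∣p∣≡0⇒p≡⊥ []            _  = refl
∣p∣≡0⇒p≡⊥ (outside ∷ p) eq = cong (outside ∷_) (∣p∣≡0⇒p≡⊥ p eq)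

∣p∣≡1⇒p≡⁅x⁆ : ∀ {n} (p : Subset n) → ∣ p ∣ ≡ 1 → ∃[ x ] p ≡ ⁅ x ⁆
∣p∣≡1⇒p≡⁅x⁆ (inside ∷ p)  eq = zero , cong (inside ∷_) (∣p∣≡0⇒p≡⊥ p (ℕ.suc-injective eq))
∣p∣≡1⇒p≡⁅x⁆ (outside ∷ p) eq with ∣p∣≡1⇒p≡⁅x⁆ p eq
... | x , p≡ = suc x , cong (outside ∷_) p≡

∣p∣≡2⇒p≡⁅x⁆∪⁅y⁆ : ∀ {n} (p : Subset n) → ∣ p ∣ ≡ 2 →
                  ∃[ x ] ∃[ y ] x ≢ y × p ≡ ⁅ x ⁆ ∪ ⁅ y ⁆
∣p∣≡2⇒p≡⁅x⁆∪⁅y⁆ (inside ∷ p) eq with ∣p∣≡1⇒p≡⁅x⁆ p (ℕ.suc-injective eq)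
... | y , p≡ = zero , suc y , (λ ()) , cong (inside ∷_) (trans p≡ (sym (∪-identityˡ ⁅ y ⁆)))
∣p∣≡2⇒p≡⁅x⁆∪⁅y⁆ (outside ∷ p) eq with ∣p∣≡2⇒p≡⁅x⁆∪⁅y⁆ p eq
... | x , y , x≢y , p≡ = suc x , suc y , (λ { refl → x≢y refl }) , cong (outside ∷_) p≡

module _ {v : ℕ} where
  open BIBD (twoSubsetBIBD v)

  points-injective : ∀ {A B} → points A ≡ points B → A ≡ B
  points-injective = lookup-injective (Unique.filter⁺ (λ A → ∣ A ∣ ℕ.≟ 2) (subsets-unique v))

  edge : ∀ {x u : Fin v} → x ≢ u → ∃[ A ] points A ≡ ⁅ x ⁆ ∪ ⁅ u ⁆
  edge {x} {u} x≢u = index e∈ , sym (lookup-index e∈)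
    where
    e∈ : ⁅ x ⁆ ∪ ⁅ u ⁆ ∈ᴸ blocks
    e∈ = ∈-filter⁺ (λ A → ∣ A ∣ ℕ.≟ 2) (∈-subsets _) (∣⁅x⁆∪⁅y⁆∣≡2 x u x≢u)

  module FromNesting {w : ℕ} (S : StrongNesting (twoSubsetBIBD v) w) where
    open StrongNesting S

    colour : Fin v → Fin v → Fin w
    colour x u with x ≟ u
    -- A loop is not an edge; `ι x` merely supplies some point of Y.
    ... | yes _  = ι x
    ... | no x≢u = φ (proj₁ (edge x≢u))

    colour-edge : ∀ {x u} → x ≢ u → ∃[ A ] points A ≡ ⁅ x ⁆ ∪ ⁅ u ⁆ × colour x u ≡ φ A
    colour-edge {x} {u} x≢u with x ≟ u
    ... | yes x≡u = contradiction x≡u x≢u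
    ... | no  x≢u = proj₁ (edge x≢u) , proj₂ (edge x≢u) , refl

    symmetric : ∀ x u → colour x u ≡ colour u x
    symmetric x u with x ≟ u | u ≟ x
    ... | yes refl | yes _   = refl
    ... | yes refl | no  u≢x = contradiction refl u≢x
    ... | no  x≢u  | yes u≡x = contradiction (sym u≡x) x≢u
    ... | no  x≢u  | no  u≢x = cong φ (points-injective
      (trans (proj₂ (edge x≢u)) (trans (∪-comm ⁅ x ⁆ ⁅ u ⁆) (sym (proj₂ (edge u≢x))))))

    -- Two edges at `x` of one colour yield the same pair, so `distinct` makes them the same block.
    proper : ∀ {x u u′} → x ≢ u → x ≢ u′ → colour x u ≡ colour x u′ → u ≡ u′
    proper {x} {u} {u′} x≢u x≢u′ eq with colour-edge x≢u | colour-edge x≢u′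
    ... | A , A≡ , cA | B , B≡ , cB
      with ⁅x⁆∪⁅y⁆-injective (trans (sym A≡) (trans (cong points A≡B) B≡))
      where
      A≡B : A ≡ B
      A≡B = proj₁ (distinct A B x x (subst (x ∈_) (sym A≡) (x∈⁅x⁆∪⁅y⁆ x u))
                                    (subst (x ∈_) (sym B≡) (x∈⁅x⁆∪⁅y⁆ x u′))
                                    (cong (λ z → ⁅ ι x ⁆ ∪ ⁅ z ⁆) (trans (sym cA) (trans eq cB))))
    ... | inj₁ (_ , u≡u′)    = u≡u′
    ... | inj₂ (x≡u′ , _)    = contradiction x≡u′ x≢u′

    -- Both blocks would yield the pair of `ι x` and `ι y`. Then `distinct` gives `x ≡ y`, and the
    -- first block is sent to its own point `x`, against `φ-avoids`.
    asymmetric : ∀ {x y u u′} → x ≢ u → y ≢ u′ → colour x u ≡ ι y → colour y u′ ≢ ι x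
    asymmetric {x} {y} {u} {u′} x≢u y≢u′ xu yu′ with colour-edge x≢u | colour-edge y≢u′
    ... | A , A≡ , cA | B , B≡ , cB = φ-avoids A x x∈A (trans (sym cA) (trans xu (cong ι (sym x≡y))))
      where
      x∈A : x ∈ points A
      x∈A = subst (x ∈_) (sym A≡) (x∈⁅x⁆∪⁅y⁆ x u)

      pairs : pair A x ≡ pair B y
      pairs = begin
        ⁅ ι x ⁆ ∪ ⁅ φ A ⁆  ≡⟨ cong (λ z → ⁅ ι x ⁆ ∪ ⁅ z ⁆) (trans (sym cA) xu) ⟩
        ⁅ ι x ⁆ ∪ ⁅ ι y ⁆  ≡⟨ ∪-comm ⁅ ι x ⁆ ⁅ ι y ⁆ ⟩
        ⁅ ι y ⁆ ∪ ⁅ ι x ⁆  ≡⟨ cong (λ z → ⁅ ι y ⁆ ∪ ⁅ z ⁆) (trans (sym yu′) cB) ⟩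
        ⁅ ι y ⁆ ∪ ⁅ φ B ⁆  ∎
        where open ≡-Reasoning

      x≡y : x ≡ y
      x≡y = proj₂ (distinct A B x y x∈A (subst (y ∈_) (sym B≡) (x∈⁅x⁆∪⁅y⁆ y u′)) pairs)

    nestingColouring : NestingColouring v w
    nestingColouring = record
      { ι = ι ; ι-injective = Injection.injective inclusion ; colour = colour
      ; symmetric = symmetric ; proper = proper ; asymmetric = asymmetric }

  module ToNesting {w : ℕ} (C : NestingColouring v w) where
    open NestingColouring C

    endpoints : ∀ A → ∃[ x ] ∃[ y ] x ≢ y × points A ≡ ⁅ x ⁆ ∪ ⁅ y ⁆
    endpoints A = ∣p∣≡2⇒p≡⁅x⁆∪⁅y⁆ (points A) (All.lookup sizes (∈-lookup A))

    φ : Block → Fin w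
    φ A = colour (proj₁ (endpoints A)) (proj₁ (proj₂ (endpoints A)))

    -- Symmetry of `colour` makes the order of the chosen endpoints immaterial, so any point of a
    -- block can serve as its first end.
    φ-edge : ∀ A {x} → x ∈ points A → ∃[ u ] x ≢ u × points A ≡ ⁅ x ⁆ ∪ ⁅ u ⁆ × φ A ≡ colour x u
    φ-edge A x∈A with endpoints A
    ... | a , b , a≢b , A≡ with ∈⁅x⁆∪⁅y⁆⁻ a b (subst (_ ∈_) A≡ x∈A)
    ... | inj₁ refl = b , a≢b , A≡ , refl
    ... | inj₂ refl = a , a≢b ∘ sym , trans A≡ (∪-comm ⁅ a ⁆ ⁅ b ⁆) , symmetric a b

    -- If the equal pairs match crosswise, asymmetry is violated; if they match in order, `x ≡ y`
    -- and properness identifies the other ends.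
    distinct : ∀ A B x y → x ∈ points A → y ∈ points B →
               ⁅ ι x ⁆ ∪ ⁅ φ A ⁆ ≡ ⁅ ι y ⁆ ∪ ⁅ φ B ⁆ → A ≡ B × x ≡ y
    distinct A B x y x∈A y∈B eq with φ-edge A x∈A | φ-edge B y∈B
    ... | u , x≢u , A≡ , cA | u′ , y≢u′ , B≡ , cB with ⁅x⁆∪⁅y⁆-injective eq
    ... | inj₂ (ιx≡ , φA≡) = contradiction (trans (sym cB) (sym ιx≡))
                                           (asymmetric x≢u y≢u′ (trans (sym cA) φA≡))
    ... | inj₁ (ιx≡ , φA≡) with refl ← ι-injective ιx≡ =
      points-injective (trans A≡ (trans (cong (λ z → ⁅ x ⁆ ∪ ⁅ z ⁆) u≡u′) (sym B≡))) , refl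
      where
      u≡u′ : u ≡ u′
      u≡u′ = proper x≢u y≢u′ (trans (sym cA) (trans φA≡ cB))

    strongNesting : StrongNesting (twoSubsetBIBD v) w
    strongNesting = record
      { inclusion = mk↣ ι-injective
      ; φ         = φ
      -- Avoidance is the case `y = x` of asymmetry, with the same edge used twice.
      ; φ-avoids  = λ A x x∈A φA≡ιx → let _ , x≢u , _ , cA = φ-edge A x∈A
                                          xu = trans (sym cA) φA≡ιx
                                      in asymmetric x≢u x≢u xu xu
      ; distinct  = distinct
      }

-- Finite sums and indicators.

open import Algebra.Properties.Semiring.Sum ℕ.+-*-semiring
open import Data.Bool.Base using (if_then_else_)
open import Data.Nat.Base using (_+_; _*_; _∸_; _≤_; _≥_; z≤n)
open import Data.Nat.Tactic.RingSolver using (solve-∀)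
open ≡-Reasoning

𝟙 : {P : Set} → Dec P → ℕ
𝟙 P? = if does P? then 1 else 0

𝟙¬+𝟙≡1 : {P : Set} (P? : Dec P) → 𝟙 (¬? P?) + 𝟙 P? ≡ 1
𝟙¬+𝟙≡1 (yes _) = refl
𝟙¬+𝟙≡1 (no _)  = refl

sum-const : ∀ n k → ∑[ i < n ] k ≡ n * k
sum-const zero    k = refl
sum-const (suc n) k = cong (k +_) (sum-const n k)

sum-mono-≤ : ∀ {n} {f g : Fin n → ℕ} → (∀ i → f i ≤ g i) → sum f ≤ sum g
sum-mono-≤ {zero}  f≤g = z≤n
sum-mono-≤ {suc n} f≤g = ℕ.+-mono-≤ (f≤g zero) (sum-mono-≤ (f≤g ∘ suc))

sum-𝟙-none : ∀ {n} {P : Fin n → Set} (P? : ∀ i → Dec (P i)) → (∀ i → ¬ P i) → sum (𝟙 ∘ P?) ≡ 0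
sum-𝟙-none {n} P? ¬P = trans (sum-cong-≗ 𝟙≡0) (trans (sum-const n 0) (ℕ.*-zeroʳ n))
  where
  𝟙≡0 : ∀ i → 𝟙 (P? i) ≡ 0
  𝟙≡0 i with P? i
  ... | yes p = contradiction p (¬P i)
  ... | no  _ = refl

sum-𝟙-unique : ∀ {n} {P : Fin n → Set} (P? : ∀ i → Dec (P i)) →
               (∀ {i j} → P i → P j → i ≡ j) → sum (𝟙 ∘ P?) ≤ 1
sum-𝟙-unique {zero}  P? unique = z≤n
sum-𝟙-unique {suc n} P? unique with P? zero
... | yes p = ℕ.≤-reflexive (cong suc (sum-𝟙-none (P? ∘ suc) λ i q → contradiction (unique p q) λ ()))
... | no  _ = sum-𝟙-unique (P? ∘ suc) λ p q → suc-injective (unique p q)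

sum-𝟙≟ : ∀ {n} (a : Fin n) (f : Fin n → ℕ) → ∑[ i < n ] (𝟙 (a ≟ i) * f i) ≡ f a
sum-𝟙≟ {suc n} zero f = begin
  1 * f zero + ∑[ i < n ] 0  ≡⟨ cong₂ _+_ (ℕ.*-identityˡ (f zero)) (trans (sum-const n 0) (ℕ.*-zeroʳ n)) ⟩
  f zero + 0                 ≡⟨ ℕ.+-identityʳ (f zero) ⟩
  f zero                     ∎
sum-𝟙≟ (suc a) f = sum-𝟙≟ a (f ∘ suc)

sum-𝟙≟-1 : ∀ {n} (a : Fin n) → ∑[ i < n ] 𝟙 (a ≟ i) ≡ 1
sum-𝟙≟-1 a = trans (sum-cong-≗ λ i → sym (ℕ.*-identityʳ (𝟙 (a ≟ i)))) (sum-𝟙≟ a (λ _ → 1))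

-- Grouping the left side by the value `z` of `ι`, each `f z` is weighted by the size of its fibre,
-- which is at most 1.
sum-∘-injective-≤ : ∀ {m n} {ι : Fin m → Fin n} → (∀ {x y} → ι x ≡ ι y → x ≡ y) →
                    ∀ f → sum (f ∘ ι) ≤ sum f
sum-∘-injective-≤ {m} {n} {ι} ι-inj f = subst (_≤ sum f) lhs (sum-mono-≤ bound)
  where
  lhs : ∑[ z < n ] ((∑[ y < m ] 𝟙 (ι y ≟ z)) * f z) ≡ sum (f ∘ ι)
  lhs = begin
    ∑[ z < n ] ((∑[ y < m ] 𝟙 (ι y ≟ z)) * f z)  ≡⟨ sum-cong-≗ (λ z → *-distribʳ-sum (f z) (λ y → 𝟙 (ι y ≟ z))) ⟩
    ∑[ z < n ] ∑[ y < m ] (𝟙 (ι y ≟ z) * f z)    ≡⟨ ∑-comm (λ z y → 𝟙 (ι y ≟ z) * f z) ⟩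
    ∑[ y < m ] ∑[ z < n ] (𝟙 (ι y ≟ z) * f z)    ≡⟨ sum-cong-≗ (λ y → sum-𝟙≟ (ι y) f) ⟩
    sum (f ∘ ι)                                  ∎

  bound : ∀ z → (∑[ y < m ] 𝟙 (ι y ≟ z)) * f z ≤ f z
  bound z = subst ((∑[ y < m ] 𝟙 (ι y ≟ z)) * f z ≤_) (ℕ.*-identityˡ (f z))
    (ℕ.*-monoˡ-≤ (f z) (sum-𝟙-unique (λ y → ι y ≟ z) λ p q → ι-inj (trans p (sym q))))

-- Entries off the diagonal pair up: the induction removes the first row and the first column, whose
-- sums agree.
sum-symmetric-even : ∀ {n} (f : Fin n → Fin n → ℕ) → (∀ x y → f x y ≡ f y x) → (∀ x → f x x ≡ 0) →
                     ∃[ k ] ∑[ x < n ] ∑[ y < n ] f x y ≡ 2 * k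
sum-symmetric-even {zero}  f _    _    = 0 , refl
sum-symmetric-even {suc n} f symf diag
  with k , eq ← sum-symmetric-even (λ x y → f (suc x) (suc y)) (λ x y → symf (suc x) (suc y)) (diag ∘ suc)
  = row + k , (begin
    f zero zero + row + ∑[ x < n ] (f (suc x) zero + ∑[ y < n ] f (suc x) (suc y))
      ≡⟨ cong₂ _+_ (cong (_+ row) (diag zero))
                   (∑-distrib-+ (λ x → f (suc x) zero) (λ x → ∑[ y < n ] f (suc x) (suc y))) ⟩
    row + (∑[ x < n ] f (suc x) zero + ∑[ x < n ] ∑[ y < n ] f (suc x) (suc y))
      ≡⟨ cong (row +_) (cong₂ _+_ (sum-cong-≗ (λ x → symf (suc x) zero)) eq) ⟩
    row + (row + 2 * k)
      ≡⟨ double row k ⟩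
    2 * (row + k) ∎)
  where
  row = ∑[ y < n ] f zero (suc y)
  double : ∀ r k → r + (r + 2 * k) ≡ 2 * (r + k)
  double = solve-∀

-- Counting the points saturated by each colour.

module LowerBound {v w : ℕ} (C : NestingColouring v w) where
  open NestingColouring C

  Coloured : Fin v → Fin w → Fin v → Set
  Coloured x z u = x ≢ u × colour x u ≡ z

  coloured? : ∀ x z u → Dec (Coloured x z u)
  coloured? x z u = ¬? (x ≟ u) ×-dec (colour x u ≟ z)

  -- By properness this is 0 or 1, the indicator that `z` saturates `x`; as a sum over edges it
  -- allows the order of summation to be exchanged.
  at : Fin v → Fin w → ℕ
  at x z = ∑[ u < v ] 𝟙 (coloured? x z u)

  saturated : Fin w → ℕ
  saturated z = ∑[ x < v ] at x z

  at≤1 : ∀ x z → at x z ≤ 1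
  at≤1 x z = sum-𝟙-unique (coloured? x z) λ (x≢u , p) (x≢u′ , q) → proper x≢u x≢u′ (trans p (sym q))

  saturated≤v : ∀ z → saturated z ≤ v
  saturated≤v z = subst (saturated z ≤_) (trans (sum-const v 1) (ℕ.*-identityʳ v)) (sum-mono-≤ λ x → at≤1 x z)

  -- Every edge of colour `z` is counted once at each end.
  saturated-even : ∀ z → ∃[ k ] saturated z ≡ 2 * k
  saturated-even z = sum-symmetric-even (λ x u → 𝟙 (coloured? x z u)) sym-𝟙 diag
    where
    sym-𝟙 : ∀ x u → 𝟙 (coloured? x z u) ≡ 𝟙 (coloured? u z x)
    sym-𝟙 x u rewrite symmetric u x with x ≟ u | u ≟ x
    ... | yes _   | yes _   = refl
    ... | yes x≡u | no  u≢x = contradiction (sym x≡u) u≢x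
    ... | no  x≢u | yes u≡x = contradiction (sym u≡x) x≢u
    ... | no  _   | no  _   = refl
    diag : ∀ x → 𝟙 (coloured? x z x) ≡ 0
    diag x with x ≟ x
    ... | yes _   = refl
    ... | no  x≢x = contradiction refl x≢x

  sum-at : ∀ x → ∑[ z < w ] at x z ≡ ∑[ u < v ] 𝟙 (¬? (x ≟ u))
  sum-at x = trans (∑-comm (λ z u → 𝟙 (coloured? x z u))) (sum-cong-≗ once)
    where
    once : ∀ u → ∑[ z < w ] 𝟙 (coloured? x z u) ≡ 𝟙 (¬? (x ≟ u))
    once u with x ≟ u
    ... | yes _ = trans (sum-const w 0) (ℕ.*-zeroʳ w)
    ... | no  _ = sum-𝟙≟-1 (colour x u)

  -- Asymmetry leaves at most one term nonzero, and properness bounds it by 1. For `x = y` asymmetry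
  -- of an edge with itself makes both terms vanish.
  at-ι : ∀ x y → at y (ι x) + at x (ι y) ≤ 𝟙 (¬? (x ≟ y))
  at-ι x y with any? (coloured? y (ι x)) | any? (coloured? x (ι y))
  ... | yes (_ , y≢u , p) | yes (_ , x≢u , q) = contradiction q (asymmetric y≢u x≢u p)
  ... | yes (_ , y≢u , p) | no  none rewrite sum-𝟙-none (coloured? x (ι y)) (λ u → none ∘ (u ,_))
      | ℕ.+-identityʳ (at y (ι x)) with x ≟ y
  ...   | yes refl = contradiction p (asymmetric y≢u y≢u p)
  ...   | no  _    = at≤1 y (ι x)
  at-ι x y | no none | q? rewrite sum-𝟙-none (coloured? y (ι x)) (λ u → none ∘ (u ,_)) with q?
  ... | no none′ = ℕ.≤-trans (ℕ.≤-reflexive (sum-𝟙-none (coloured? x (ι y)) (λ u → none′ ∘ (u ,_)))) z≤n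
  ... | yes (_ , x≢u , p) with x ≟ y
  ...   | yes refl = contradiction p (asymmetric x≢u x≢u p)
  ...   | no  _    = at≤1 x (ι y)

  sum-≢ : ∀ (x : Fin v) → ∑[ u < v ] 𝟙 (¬? (x ≟ u)) + 1 ≡ v
  sum-≢ x = begin
    ∑[ u < v ] 𝟙 (¬? (x ≟ u)) + 1                        ≡⟨ cong (∑[ u < v ] 𝟙 (¬? (x ≟ u)) +_) (sym (sum-𝟙≟-1 x)) ⟩
    ∑[ u < v ] 𝟙 (¬? (x ≟ u)) + ∑[ u < v ] 𝟙 (x ≟ u)     ≡⟨ sym (∑-distrib-+ (λ u → 𝟙 (¬? (x ≟ u))) (λ u → 𝟙 (x ≟ u))) ⟩
    ∑[ u < v ] (𝟙 (¬? (x ≟ u)) + 𝟙 (x ≟ u))              ≡⟨ sum-cong-≗ (λ u → 𝟙¬+𝟙≡1 (x ≟ u)) ⟩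
    ∑[ u < v ] 1                                         ≡⟨ trans (sum-const v 1) (ℕ.*-identityʳ v) ⟩
    v                                                    ∎

2n≤2m+1⇒n≤m : ∀ {m n} → 2 * n ≤ 2 * m + 1 → n ≤ m
2n≤2m+1⇒n≤m {m} {n} le = ℕ.≮⇒≥ λ m<n → ℕ.<-irrefl refl (ℕ.<-≤-trans
  (ℕ.≤-reflexive (eq m)) (ℕ.≤-trans (ℕ.*-monoʳ-≤ 2 m<n) le))
  where
  eq : ∀ m → suc (2 * m + 1) ≡ 2 * suc m
  eq = solve-∀

-- The number of points is written as `n + 1` with `n` even and positive: evenness lowers the bound
-- on saturated points from `v` to `n`, and positivity lets the factor `n` be cancelled at the end.
3v≤2w : ∀ {s w} → NestingColouring (suc (2 * suc s)) w → 3 * suc (2 * suc s) ≤ 2 * w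
3v≤2w {s} {w} C = ℕ.*-cancelʳ-≤ (3 * v) (2 * w) n 3v*n≤2w*n
  where
  open NestingColouring C
  open LowerBound C

  n v : ℕ
  n = 2 * suc s
  v = suc n

  row : ∀ (x : Fin v) → ∑[ u < v ] 𝟙 (¬? (x ≟ u)) ≡ n
  row x = ℕ.+-cancelʳ-≡ 1 _ n (trans (sum-≢ x) (ℕ.+-comm 1 n))

  total : sum saturated ≡ v * n
  total = trans (∑-comm (λ z x → at x z))
                (trans (sum-cong-≗ (λ x → trans (sum-at x) (row x))) (sum-const v n))

  saturated≤n : ∀ z → saturated z ≤ n
  saturated≤n z with k , eq ← saturated-even z = subst (_≤ n) (sym eq)
    (ℕ.*-monoʳ-≤ 2 (2n≤2m+1⇒n≤m {suc s} {k} (subst₂ _≤_ eq (ℕ.+-comm 1 n) (saturated≤v z))))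

  -- Summing `at-ι` over all ordered pairs counts each incidence of a colour from X twice.
  saturated-ι : 2 * sum (saturated ∘ ι) ≤ v * n
  saturated-ι = subst₂ _≤_ lhs (trans (sum-cong-≗ row) (sum-const v n))
    (sum-mono-≤ λ x → sum-mono-≤ λ y → at-ι x y)
    where
    lhs : ∑[ x < v ] ∑[ y < v ] (at y (ι x) + at x (ι y)) ≡ 2 * sum (saturated ∘ ι)
    lhs = begin
      ∑[ x < v ] ∑[ y < v ] (at y (ι x) + at x (ι y))
        ≡⟨ sum-cong-≗ (λ x → ∑-distrib-+ (λ y → at y (ι x)) (λ y → at x (ι y))) ⟩
      ∑[ x < v ] (saturated (ι x) + ∑[ y < v ] at x (ι y))
        ≡⟨ ∑-distrib-+ (saturated ∘ ι) (λ x → ∑[ y < v ] at x (ι y)) ⟩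
      sum (saturated ∘ ι) + ∑[ x < v ] ∑[ y < v ] at x (ι y)
        ≡⟨ cong (sum (saturated ∘ ι) +_) (trans (∑-comm (λ x y → at x (ι y))) (sym (ℕ.+-identityʳ _))) ⟩
      2 * sum (saturated ∘ ι) ∎

  unsaturated unsaturated-ι : ℕ
  unsaturated   = ∑[ z < w ] (n ∸ saturated z)
  unsaturated-ι = ∑[ y < v ] (n ∸ saturated (ι y))

  complement : ∀ {m} (f : Fin m → Fin w) →
               ∑[ z < m ] (n ∸ saturated (f z)) + sum (saturated ∘ f) ≡ m * n
  complement {m} f = begin
    ∑[ z < m ] (n ∸ saturated (f z)) + sum (saturated ∘ f)   ≡⟨ sym (∑-distrib-+ (λ z → n ∸ saturated (f z)) (saturated ∘ f)) ⟩
    ∑[ z < m ] (n ∸ saturated (f z) + saturated (f z))       ≡⟨ sum-cong-≗ (λ z → ℕ.m∸n+n≡m (saturated≤n (f z))) ⟩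
    ∑[ z < m ] n                                             ≡⟨ sum-const m n ⟩
    m * n                                                    ∎

  -- The colours from X alone have this much deficiency, being saturated at no more than half of
  -- their `v * n` places; injectivity of `ι` carries it over to all of Y.
  v*n≤2*unsaturated : v * n ≤ 2 * unsaturated
  v*n≤2*unsaturated = ℕ.≤-trans
    (ℕ.+-cancelʳ-≤ (v * n) _ _ (ℕ.≤-trans (ℕ.≤-reflexive split) (ℕ.+-monoʳ-≤ (2 * unsaturated-ι) saturated-ι)))
    (ℕ.*-monoʳ-≤ 2 (sum-∘-injective-≤ ι-injective (λ z → n ∸ saturated z)))
    where
    double : ∀ a b → a + b + (a + b) ≡ 2 * a + 2 * b
    double = solve-∀
    split : v * n + v * n ≡ 2 * unsaturated-ι + 2 * sum (saturated ∘ ι)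
    split = trans (cong₂ _+_ (sym (complement ι)) (sym (complement ι)))
                  (double unsaturated-ι (sum (saturated ∘ ι)))

  3v*n≤2w*n : 3 * v * n ≤ 2 * w * n
  -- Adding `2 * (v * n)`, twice the total saturation, completes the deficiency on the right to
  -- `2 * w * n`.
  3v*n≤2w*n = subst₂ _≤_ (sym (triple v n)) twice (ℕ.+-monoˡ-≤ (2 * (v * n)) v*n≤2*unsaturated)
    where
    triple : ∀ v n → 3 * v * n ≡ v * n + 2 * (v * n)
    triple = solve-∀
    distrib : ∀ d e → 2 * d + 2 * e ≡ 2 * (d + e)
    distrib = solve-∀
    twice : 2 * unsaturated + 2 * (v * n) ≡ 2 * w * n
    twice = trans (distrib unsaturated (v * n)) (trans
      (cong (2 *_) (trans (cong (unsaturated +_) (sym total)) (complement id))) (sym (ℕ.*-assoc 2 w n)))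

-- For v = 4t + 1 the bound reads 2w ≥ 12t + 3, and parity raises the right side to 12t + 4.
lower-bound : ∀ {t w} → t ≥ 1 → NestingColouring (4 * t + 1) w → 6 * t + 2 ≤ w
lower-bound {suc t} {w} _ C = 2n≤2m+1⇒n≤m {w} (subst (_≤ 2 * w + 1) (rhs t)
  (ℕ.+-monoˡ-≤ 1 (3v≤2w {suc (t + t)} (subst (λ v → NestingColouring v w) (size t) C))))
  where
  size : ∀ t → 4 * suc t + 1 ≡ suc (2 * suc (suc (t + t)))
  size = solve-∀
  rhs : ∀ t → 3 * suc (2 * suc (suc (t + t))) + 1 ≡ 2 * (6 * suc t + 2)
  rhs = solve-∀

cyclic-colouring : ∀ t → NestingColouring (4 * t + 1) (6 * t + 2)
cyclic-colouring t = subst₂ NestingColouring (points t) (colours t) nestingColouring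
  where
  open Construction t
  points : ∀ t → suc (t + t + t + t) ≡ 4 * t + 1
  points = solve-∀
  colours : ∀ t → suc (t + t + t + t) + suc (t + t) ≡ 6 * t + 2
  colours = solve-∀

theorem4p2 : (t : ℕ) → t ≥ 1 →
    Σ (StrongNesting (twoSubsetBIBD (4 * t + 1)) (6 * t + 2)) Optimal
theorem4p2 t t≥1 = ToNesting.strongNesting (cyclic-colouring t) , λ w′ w′<w S →
  ℕ.<⇒≱ w′<w (lower-bound t≥1 (FromNesting.nestingColouring S))
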